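{- Every regular $2$-balanced $6$-partite tournament has a strong partition.
   Context: A $2$-balanced $6$-partite tournament is an orientation of the complete $6$-partite graph with all parts of size $2$; it is regular if every vertex has in-degree equal to out-degree. A partition into maximal tournaments is a pair of vertex-disjoint tournaments of order $6$ covering all vertices (each containing one vertex from each partite set); it is a strong partition if both tournaments are strongly connected. -}

module Defs where

open import Data.Nat using (ℕ)
open import Data.Fin using (Fin)
open import Data.Bool using (Bool; true; false)
open import Data.Product using (_×_; _,_; proj₁; proj₂)
open import Data.Sum using (_⊎_)
open import Data.List using (List; length; filterᵇ; cartesianProduct; allFin)
open import Relation.Binary.PropositionalEquality using (_≡_; _≢_)
open import Relation.Nullary using (¬_)

-- Vertices of the complete 6-partite graph with parts of size 2:
-- vertex (i , j) is the j-th vertex of partite set i.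
Vertex : Set
Vertex = Fin 6 × Fin 2

allVertices : List Vertex
allVertices = cartesianProduct (allFin 6) (allFin 2)

Digraph : Set
Digraph = Vertex → Vertex → Bool

record IsMultipartiteTournament (D : Digraph) : Set where
  field
    noArcInPart : ∀ u v → proj₁ u ≡ proj₁ v → D u v ≡ false
    someArc     : ∀ u v → proj₁ u ≢ proj₁ v → D u v ≡ true ⊎ D v u ≡ true
    notBoth     : ∀ u v → ¬ (D u v ≡ true × D v u ≡ true)

outdeg : Digraph → Vertex → ℕ
outdeg D v = length (filterᵇ (λ w → D v w) allVertices)

indeg : Digraph → Vertex → ℕ
indeg D v = length (filterᵇ (λ w → D w v) allVertices)

IsRegular : Digraph → Set
IsRegular D = ∀ v → indeg D v ≡ outdeg D v

-- A maximal tournament inside the multipartite tournament is given by choosing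
-- one vertex from each partite set: the vertex set {(i , f i) | i : Fin 6}.
Choice : Set
Choice = Fin 6 → Fin 2

data Reach (D : Digraph) (f : Choice) : Fin 6 → Fin 6 → Set where
  here : ∀ {i} → Reach D f i i
  step : ∀ {i j k} → D (i , f i) (j , f j) ≡ true → Reach D f j k → Reach D f i k

StronglyConnected : Digraph → Choice → Set
StronglyConnected D f = ∀ i j → Reach D f i j

-- A partition into maximal tournaments: two vertex-disjoint tournaments of order 6,
-- each containing one vertex from each partite set (hence covering all 12 vertices).
-- It is strong if both tournaments are strongly connected.
record StrongPartition (D : Digraph) : Set where
  field
    T₁ T₂    : Choice
    disjoint : ∀ i → T₁ i ≢ T₂ i
    strong₁  : StronglyConnected D T₁
    strong₂  : StronglyConnected D T₂

{-# OPTIONS --safe #-}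

-- Regularity enters only through the fact that no vertex has six in- or out-neighbours.
--
-- A vertex v is the source of at most one maximal tournament, since two different ones would give
-- it six out-neighbours; likewise for sinks. There are 12 vertices and 2 roles but 32 partitions,
-- so in some partition neither tournament T has a source or a sink. If such a T is not strong, it
-- consists of two 3-cycles A and B with all arcs from A to B, and then every a in A has at most one
-- out-neighbour, and every b in B at most one in-neighbour, outside T ("hits").
--
-- Exchange T with its complement except at the parts of some a in A and b in B. Both tournaments
-- of the new partition follow the cyclic pattern  complement of T → A → B → complement of T,  up
-- to hits, and are strong unless a vertex outside T is a source or a sink. Such a vertex takes part
-- in the hits of two members of T; the 9 choices of (a, b) would need 18 pairs of a member and a
-- role (source or sink), but only 12 exist.
module Submission where

open import Data.Bool using (Bool; true; false)
open import Data.Bool.Properties using (T?; T-≡) renaming (_≟_ to _≟ᵇ_)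
open import Data.Empty using (⊥-elim)
open import Data.Fin using (Fin; zero; suc; _≟_; combine; remQuot; finToFun; funToFin; opposite)
open import Data.Fin.Patterns using (0F; 1F; 2F)
open import Data.Fin.Properties
  using (all?; any?; ¬∀⟶∃¬; <⇒notInjective; combine-injective; combine-remQuot;
         funToFin-finToFin; opposite-involutive)
open import Data.Fin.Subset using (Subset; _∈_; _∉_; _∪_; ⁅_⁆; ∣_∣)
open import Data.Fin.Subset.Properties
  using (_∈?_; anySubset?; x∈⁅x⁆; x∈⁅y⁆⇒x≡y; x∈p∪q⁺; x∈p∪q⁻; p⊂q⇒∣p∣<∣q∣; ∣p∣≤n)
open import Data.List using (List; []; _∷_; length; filterᵇ)
open import Data.List.Membership.DecPropositional (_≟_ {6}) using () renaming (_∈?_ to _∈ˡ?_)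
open import Data.List.Membership.Propositional using () renaming (_∈_ to _∈ˡ_; _∉_ to _∉ˡ_)
open import Data.List.Membership.Propositional.Properties
  using (∈-filter⁺; ∈-cartesianProduct⁺; ∈-allFin)
import Data.List.Membership.Setoid.Properties as Membership
open import Data.List.Relation.Unary.Any using (here; there; index)
open import Data.Nat as ℕ using (zero; suc; z≤n; s≤s; _+_; _*_; _≤_; _<_)
import Data.Nat.Properties as ℕ
open import Data.Product using (∃; ∃₂; _×_; _,_; proj₁; proj₂; uncurry)
open import Data.Product.Properties using (,-injectiveˡ)
open import Data.Sum as Sum using (_⊎_; inj₁; inj₂; [_,_]′)
open import Function using (_∘_; id; Equivalence)
open import Function.Definitions using (Injective)
open import Relation.Binary.PropositionalEquality
  using (_≡_; _≢_; _≗_; refl; sym; trans; cong; cong₂; subst; setoid; ≢-sym)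
open import Relation.Nullary
  using (¬_; Dec; yes; no; does; contradiction; ¬?; _×-dec_; _⊎-dec_; _→-dec_)
open import Relation.Nullary.Decidable using (from-yes; from-no; decidable-stable; map′)
open import Relation.Unary using (Decidable)

open import Defs

-- Reversal and degree bounds

infix 8 _ᵒᵖ

_ᵒᵖ : Digraph → Digraph
(D ᵒᵖ) u v = D v u

Arc : Digraph → Choice → Fin 6 → Fin 6 → Set
Arc D T i j = D (i , T i) (j , T j) ≡ true

-- Phrased by injections instead of a count, so that a contradiction arises from listing six
-- distinct out-neighbours.
OutBounded : Digraph → Set
OutBounded D = ∀ v (g : Fin 6 → Vertex) → Injective _≡_ _≡_ g → ¬ (∀ i → D v (g i) ≡ true)

-- Invariant under reversing all arcs, so every result about sources also serves for sinks.
record Tame (D : Digraph) : Set where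
  field
    tournament : IsMultipartiteTournament D
    outBounded : OutBounded D
    inBounded  : OutBounded (D ᵒᵖ)
  open IsMultipartiteTournament tournament public

Tame-ᵒᵖ : ∀ {D} → Tame D → Tame (D ᵒᵖ)
Tame-ᵒᵖ tame = record
  { tournament = record
    { noArcInPart = λ u v eq → noArcInPart v u (sym eq)
    ; someArc     = λ u v u≢v → someArc v u (≢-sym u≢v)
    ; notBoth     = λ u v → notBoth v u
    }
  ; outBounded = inBounded
  ; inBounded  = outBounded
  } where open Tame tame

-- Regularity

-- Applied to the out-neighbours, the in-neighbours and the part of a vertex, which are pairwise
-- disjoint among the 12 vertices.
length-filter-disjoint : ∀ {A : Set} (p q r : A → Bool) →
  (∀ x → ¬ (p x ≡ true × q x ≡ true)) → (∀ x → r x ≡ true → p x ≡ false × q x ≡ false) →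
  ∀ xs → length (filterᵇ p xs) + length (filterᵇ q xs) + length (filterᵇ r xs) ≤ length xs
length-filter-disjoint p q r pq r-pq [] = z≤n
length-filter-disjoint p q r pq r-pq (x ∷ xs)
  with p x in px | q x in qx | r x in rx | length-filter-disjoint p q r pq r-pq xs
... | true  | true  | _     | _  = contradiction (px , qx) (pq x)
... | true  | false | true  | _  = contradiction (trans (sym px) (proj₁ (r-pq x rx))) λ ()
... | true  | false | false | ih = s≤s ih
... | false | true  | true  | _  = contradiction (trans (sym qx) (proj₂ (r-pq x rx))) λ ()
... | false | true  | false | ih rewrite ℕ.+-suc (length (filterᵇ p xs)) (length (filterᵇ q xs)) = s≤s ih
... | false | false | false | ih = ℕ.m≤n⇒m≤1+n ih
... | false | false | true  | ih
  rewrite ℕ.+-suc (length (filterᵇ p xs) + length (filterᵇ q xs)) (length (filterᵇ r xs)) = s≤s ih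

part-size : ∀ i → length (filterᵇ (λ w → does (i ≟ proj₁ w)) allVertices) ≡ 2
part-size = from-yes (all? λ i → length (filterᵇ (λ w → does (i ≟ proj₁ w)) allVertices) ℕ.≟ 2)

bounded : ∀ (p : Vertex → Bool) → length (filterᵇ p allVertices) ≤ 5 →
  ∀ (g : Fin 6 → Vertex) → Injective _≡_ _≡_ g → ¬ (∀ i → p (g i) ≡ true)
bounded p few g g-inj pg = <⇒notInjective (s≤s few) λ {i} {j} eq →
  g-inj (Membership.index-injective (setoid Vertex) (g∈ i) (g∈ j) eq)
  where
  g∈ : ∀ i → g i ∈ˡ filterᵇ p allVertices
  g∈ i = ∈-filter⁺ (T? ∘ p) (∈-cartesianProduct⁺ (∈-allFin (proj₁ (g i))) (∈-allFin (proj₂ (g i))))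
           (Equivalence.from T-≡ (pg i))

regular⇒tame : ∀ {D} → IsMultipartiteTournament D → IsRegular D → Tame D
regular⇒tame {D} tournament regular = record
  { tournament = tournament
  ; outBounded = λ v → bounded (D v) (out≤5 v)
  ; inBounded  = λ v → bounded (λ w → D w v) (subst (_≤ 5) (sym (regular v)) (out≤5 v))
  }
  where
  open IsMultipartiteTournament tournament

  samePart : Vertex → Vertex → Bool
  samePart v w = does (proj₁ v ≟ proj₁ w)

  samePart-noArcs : ∀ v w → samePart v w ≡ true → D v w ≡ false × D w v ≡ false
  samePart-noArcs v w same with proj₁ v ≟ proj₁ w
  ... | yes eq = noArcInPart v w eq , noArcInPart w v (sym eq)

  out≤5 : ∀ v → outdeg D v ≤ 5
  out≤5 v = halve (outdeg D v) (subst (λ n → outdeg D v + n + 2 ≤ 12) (regular v)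
    (subst (λ n → outdeg D v + indeg D v + n ≤ 12) (part-size (proj₁ v))
      (length-filter-disjoint (D v) (λ w → D w v) (samePart v)
        (notBoth v) (samePart-noArcs v) allVertices)))
    where
    halve : ∀ n → n + n + 2 ≤ 12 → n ≤ 5
    -- Six out-neighbours would force 6 + 6 + 2 = 14 vertices. The strict comparison reads 13 <
    -- `n + n + 2`, so the bound 12 is weakened to 13.
    halve n bound = ℕ.≮⇒≥ λ 5<n → ℕ.<⇒≱ (ℕ.+-monoˡ-≤ 2 (ℕ.+-mono-≤ 5<n 5<n))
      (ℕ.≤-trans bound (ℕ.n≤1+n 12))

-- Overfull neighbourhoods

_[_≔_] : (Fin 6 → Vertex) → Fin 6 → Vertex → (Fin 6 → Vertex)
(g [ i ≔ w ]) j with j ≟ i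
... | yes _ = w
... | no _  = g j

≔-injective : ∀ {g i w} → Injective _≡_ _≡_ g → (∀ j → g j ≢ w) → Injective _≡_ _≡_ (g [ i ≔ w ])
≔-injective {g} {i} g-inj w∉g {j} {k} eq with j ≟ i | k ≟ i
... | yes j≡i | yes k≡i = trans j≡i (sym k≡i)
... | yes _   | no _    = contradiction (sym eq) (w∉g k)
... | no _    | yes _   = contradiction eq (w∉g j)
... | no _    | no _    = g-inj eq

≔-all : ∀ {g i w} {P : Vertex → Set} → P w → (∀ j → j ≢ i → P (g j)) → ∀ j → P ((g [ i ≔ w ]) j)
≔-all {i = i} Pw Pg j with j ≟ i
... | yes _  = Pw
... | no j≢i = Pg j j≢i

members : Choice → Fin 6 → Vertex
members T i = i , T i

members-injective : ∀ T → Injective _≡_ _≡_ (members T)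
members-injective T = ,-injectiveˡ

nonmember : ∀ {T : Choice} {k c} → c ≢ T k → ∀ j → members T j ≢ (k , c)
nonmember c≢ j refl = c≢ refl

Source : Digraph → Choice → Fin 6 → Set
Source D T i = ∀ j → j ≢ i → Arc D T i j

module _ {D} (tame : Tame D) where
  open Tame tame

  arc? : ∀ T i j → Dec (Arc D T i j)
  arc? T i j = D (i , T i) (j , T j) ≟ᵇ true

  arc-total : ∀ {i j} c d → i ≢ j → D (i , c) (j , d) ≡ true ⊎ D (j , d) (i , c) ≡ true
  arc-total c d = someArc (_ , c) (_ , d)

  arc-irrefl : ∀ {u v} → D u v ≡ true → proj₁ u ≢ proj₁ v
  arc-irrefl {u} {v} uv eq = contradiction (trans (sym uv) (noArcInPart u v eq)) λ ()

  -- The source has five out-neighbours in `T`; a foreign one (outside `T`), listed in place of the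
  -- source itself, would be the sixth.
  source-loses : ∀ {T i} → Source D T i → ∀ {k c} → c ≢ T k → ¬ D (i , T i) (k , c) ≡ true
  source-loses {T} {i} src {k} {c} c≢ ik = outBounded (i , T i) (members T [ i ≔ (k , c) ])
    (≔-injective (members-injective T) (nonmember c≢))
    (≔-all {P = λ v → D (i , T i) v ≡ true} ik src)

  -- If the two tournaments differed at `j`, the vertex `T′ j` would be a foreign out-neighbour of a
  -- source of `T`.
  source-unique : ∀ {T T′ i} → T i ≡ T′ i → Source D T i → Source D T′ i → ∀ j → T j ≡ T′ j
  source-unique {T} {T′} {i} eq src src′ j with T j ≟ T′ j | j ≟ i
  ... | yes same | _       = same
  ... | no _     | yes refl = eq
  ... | no differ | no j≢i = contradiction
    (subst (λ c → D (i , c) (j , T′ j) ≡ true) (sym eq) (src′ j j≢i))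
    (source-loses src (≢-sym differ))

  -- In the list of members the entries of `i` and `q` are free. Two foreign out-neighbours in
  -- different parts would fill them and complete six out-neighbours.
  exit-unique : ∀ {T i q} → (∀ j → j ≢ i → j ≢ q → Arc D T i j) →
    ∀ {k c l d} → c ≢ T k → d ≢ T l →
    D (i , T i) (k , c) ≡ true → D (i , T i) (l , d) ≡ true → k ≡ l
  exit-unique {T} {i} {q} beats {k} {c} {l} {d} c≢ d≢ ik il with k ≟ l
  ... | yes k≡l = k≡l
  ... | no k≢l = ⊥-elim (outBounded (i , T i) (members T [ i ≔ (k , c) ] [ q ≔ (l , d) ])
    (≔-injective (≔-injective (members-injective T) (nonmember c≢))
      (≔-all {P = _≢ (l , d)} (k≢l ∘ cong proj₁) λ j _ → nonmember d≢ j))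
    (≔-all {P = out} il λ j j≢q → outs j j≢q))
    where
    out : Vertex → Set
    out v = D (i , T i) v ≡ true
    outs : ∀ j → j ≢ q → out ((members T [ i ≔ (k , c) ]) j)
    outs j j≢q with j ≟ i
    ... | yes _  = ik
    ... | no j≢i = beats j j≢i j≢q

  source? : ∀ T i → Dec (Source D T i)
  source? T i = all? λ j → ¬? (j ≟ i) →-dec arc? T i j

  non-sink : ∀ {T i} → ¬ Source (D ᵒᵖ) T i → ∃ λ j → Arc D T i j
  non-sink {T} {i} ¬sink with ¬∀⟶∃¬ 6 _ (λ j → ¬? (j ≟ i) →-dec (D (j , T j) (i , T i) ≟ᵇ true)) ¬sink
  ... | j , ¬loses with j ≟ i
  ...   | yes j≡i = contradiction (λ j≢i → contradiction j≡i j≢i) ¬loses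
  ...   | no j≢i with arc-total (T j) (T i) j≢i
  ...     | inj₁ ji = contradiction (λ _ → ji) ¬loses
  ...     | inj₂ ij = j , ij

-- Reachability

reach-trans : ∀ {D T i j k} → Reach D T i j → Reach D T j k → Reach D T i k
reach-trans here         r′ = r′
reach-trans (step arc r) r′ = step arc (reach-trans r r′)

reach-snoc : ∀ {D T i j k} → Reach D T i j → Arc D T j k → Reach D T i k
reach-snoc r arc = reach-trans r (step arc here)

reach-ᵒᵖ : ∀ {D T i j} → Reach (D ᵒᵖ) T i j → Reach D T j i
reach-ᵒᵖ here         = here
reach-ᵒᵖ (step arc r) = reach-snoc (reach-ᵒᵖ r) arc

∀⊎ : ∀ {n} {P : Fin n → Set} {Q : Set} → (∀ i → P i ⊎ Q) → (∀ i → P i) ⊎ Q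
∀⊎ {zero}  f = inj₁ λ ()
∀⊎ {suc n} f with f zero | ∀⊎ (f ∘ suc)
... | inj₂ q | _       = inj₂ q
... | inj₁ _ | inj₂ q  = inj₂ q
... | inj₁ p | inj₁ ps = inj₁ λ { zero → p ; (suc i) → ps i }

record Cut (D : Digraph) (T : Choice) : Set where
  field
    lower      : Subset 6
    dominated  : ∀ {i j} → i ∉ lower → j ∈ lower → Arc D T i j
    inhabited  : ∃ (_∈ lower)
    proper     : ∃ (_∉ lower)

module _ {D} (tame : Tame D) (T : Choice) where

  -- `R` grows along arcs leaving it. When none leaves, `R` is everything or the lower side of a
  -- cut. `fuel` bounds the growths still possible: at zero, `R` has all six elements.
  reachable⊎cut : ∀ i fuel (R : Subset 6) → 6 ≤ fuel + ∣ R ∣ → i ∈ R →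
    (∀ {j} → j ∈ R → Reach D T i j) → (∀ j → Reach D T i j) ⊎ Cut D T
  reachable⊎cut i fuel R enough i∈R reach
    with any? (λ j → any? λ k → j ∈? R ×-dec ¬? (k ∈? R) ×-dec arc? tame T j k)
  ... | no closed with any? (λ k → ¬? (k ∈? R))
  ...   | no full = inj₁ λ j → reach (decidable-stable (j ∈? R) λ j∉R → full (j , j∉R))
  ...   | yes (k , k∉R) = inj₂ record
    { lower     = R
    ; dominated = λ {k} {j} k∉R j∈R →
        [ id , (λ jk → contradiction (j , k , j∈R , k∉R , jk) closed) ]′
        (arc-total tame (T k) (T j) λ { refl → k∉R j∈R })
    ; inhabited = i , i∈R
    ; proper    = k , k∉R
    }
  reachable⊎cut i fuel R enough i∈R reach | yes (j , k , j∈R , k∉R , jk) = extend fuel enough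
    where
    R′ : Subset 6
    R′ = R ∪ ⁅ k ⁆

    bigger : ∣ R ∣ < ∣ R′ ∣
    bigger = p⊂q⇒∣p∣<∣q∣ ((x∈p∪q⁺ ∘ inj₁) , k , x∈p∪q⁺ (inj₂ (x∈⁅x⁆ k)) , k∉R)

    reach′ : ∀ {l} → l ∈ R′ → Reach D T i l
    reach′ l∈R′ with x∈p∪q⁻ R ⁅ k ⁆ l∈R′
    ... | inj₁ l∈R = reach l∈R
    ... | inj₂ l∈k rewrite x∈⁅y⁆⇒x≡y k l∈k = reach-snoc (reach j∈R) jk

    extend : ∀ fuel → 6 ≤ fuel + ∣ R ∣ → (∀ j → Reach D T i j) ⊎ Cut D T
    extend zero       enough = contradiction (ℕ.≤-trans bigger (∣p∣≤n R′)) (ℕ.≤⇒≯ enough)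
    extend (suc fuel) enough = reachable⊎cut i fuel R′
      (ℕ.≤-trans enough (subst (_≤ fuel + ∣ R′ ∣) (ℕ.+-suc fuel ∣ R ∣) (ℕ.+-monoʳ-≤ fuel bigger)))
      (x∈p∪q⁺ (inj₁ i∈R)) reach′

  strong⊎cut : StronglyConnected D T ⊎ Cut D T
  strong⊎cut = ∀⊎ λ i → reachable⊎cut i 6 ⁅ i ⁆ (ℕ.m≤m+n 6 _) (x∈⁅x⁆ i) λ j∈i →
    subst (Reach D T i) (sym (x∈⁅y⁆⇒x≡y i j∈i)) here

-- Tournaments that are not strong

-- Exact sizes are given by explicit elements, since later arguments compare these elements with
-- each other.
One Two Three : (Fin 6 → Set) → Set
One   P = ∃ λ i → P i × ∀ l → l ≢ i → ¬ P l
Two   P = ∃ λ i → P i × ∃ λ j → P j × i ≢ j × ∀ l → l ≢ i → l ≢ j → ¬ P l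
Three P = ∃ λ i → P i × ∃ λ j → P j × i ≢ j × ∃ λ k → P k × i ≢ k × j ≢ k ×
  ∀ l → l ≢ i → l ≢ j → l ≢ k → ¬ P l

Shape : Subset 6 → Set
Shape R = One (_∈ R) ⊎ One (_∉ R) ⊎ Two (_∈ R) ⊎ Two (_∉ R) ⊎ Three (_∈ R) × Three (_∉ R)

module _ {P : Fin 6 → Set} (P? : Decidable P) where
  one? : Dec (One P)
  one? = any? λ i → P? i ×-dec all? λ l → ¬? (l ≟ i) →-dec ¬? (P? l)

  two? : Dec (Two P)
  two? = any? λ i → P? i ×-dec any? λ j → P? j ×-dec ¬? (i ≟ j) ×-dec
    all? λ l → ¬? (l ≟ i) →-dec ¬? (l ≟ j) →-dec ¬? (P? l)

  three? : Dec (Three P)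
  three? = any? λ i → P? i ×-dec any? λ j → P? j ×-dec ¬? (i ≟ j) ×-dec
    any? λ k → P? k ×-dec ¬? (i ≟ k) ×-dec ¬? (j ≟ k) ×-dec
    all? λ l → ¬? (l ≟ i) →-dec ¬? (l ≟ j) →-dec ¬? (l ≟ k) →-dec ¬? (P? l)

-- Checked by evaluation on all 64 subsets; 6 splits into two positive sizes only as 1 + 5, 2 + 4 or
-- 3 + 3.
shape : ∀ (R : Subset 6) → ∃ (_∈ R) × ∃ (_∉ R) → Shape R
shape R = decidable-stable (claim? R) λ ¬claim → from-no (anySubset? (¬? ∘ claim?)) (R , ¬claim)
  where
  claim? : Decidable λ R → ∃ (_∈ R) × ∃ (_∉ R) → Shape R
  claim? R = (any? in? ×-dec any? out?) →-dec
    (one? in? ⊎-dec one? out? ⊎-dec two? in? ⊎-dec two? out? ⊎-dec three? in? ×-dec three? out?)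
    where
    in? : Decidable (_∈ R)
    in? = _∈? R
    out? : Decidable (_∉ R)
    out? = ¬? ∘ in?

three-enumerate : ∀ {P} → Three P → Fin 3 → Fin 6
three-enumerate (i , _ , j , _ , _ , k , _) = λ { 0F → i ; 1F → j ; 2F → k }

three-injective : ∀ {P} (three : Three P) →
  ∀ m n → three-enumerate three m ≡ three-enumerate three n → m ≡ n
three-injective (i , _ , j , _ , i≢j , k , _ , i≢k , j≢k , _) = λ where
  0F 0F _  → refl
  0F 1F eq → contradiction eq i≢j
  0F 2F eq → contradiction eq i≢k
  1F 0F eq → contradiction (sym eq) i≢j
  1F 1F _  → refl
  1F 2F eq → contradiction eq j≢k
  2F 0F eq → contradiction (sym eq) i≢k
  2F 1F eq → contradiction (sym eq) j≢k
  2F 2F _  → refl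

three-member : ∀ {P} (three : Three P) m → P (three-enumerate three m)
three-member (i , Pi , j , Pj , _ , k , Pk , _) = λ { 0F → Pi ; 1F → Pj ; 2F → Pk }

-- `P` is the dominating side of a cut: the complement of `lower` in `D`, or `lower` itself in
-- `D ᵒᵖ`, where sources are the sinks of `D`.
module _ {D} (tame : Tame D) {T : Choice} {P : Fin 6 → Set} (P? : Decidable P)
  (dominating : ∀ {i j} → P i → ¬ P j → Arc D T i j) where

  one⇒source : One P → ∃ (Source D T)
  one⇒source (i , Pi , only) = i , λ l l≢i → dominating Pi (only l l≢i)

  beats-also : ∀ {i l m} → Arc D T i m → (l ≢ m → Arc D T i l) → Arc D T i l
  beats-also {l = l} {m} im otherwise with l ≟ m
  ... | yes refl = im
  ... | no l≢m   = otherwise l≢m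

  -- The arc between the two elements of `P` has a winner, and this one beats everyone else too.
  two⇒source : Two P → ∃ (Source D T)
  two⇒source (i , Pi , j , Pj , i≢j , only) with arc-total tame (T i) (T j) i≢j
  ... | inj₁ ij = i , λ l l≢i → beats-also ij λ l≢j → dominating Pi (only l l≢i l≢j)
  ... | inj₂ ji = j , λ l l≢j → beats-also ji λ l≢i → dominating Pj (only l l≢i l≢j)

  BeatsAllButOne : Fin 6 → Set
  BeatsAllButOne i = ∃ λ q → ∀ l → l ≢ i → l ≢ q → Arc D T i l

  module _ (no-source : ¬ ∃ (Source D T)) where

    -- If `i` lost to both `j` and `k`, the winner among `j` and `k` would be a source. So `i` beats
    -- one of them, and the other is the exception `q`.
    member-beats : ∀ {i j k} → P i → P j → P k → i ≢ j → i ≢ k → j ≢ k →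
      (∀ l → l ≢ i → l ≢ j → l ≢ k → ¬ P l) → BeatsAllButOne i
    member-beats {i} {j} {k} Pi Pj Pk i≢j i≢k j≢k only
      with arc-total tame (T i) (T j) i≢j | arc-total tame (T i) (T k) i≢k
         | arc-total tame (T j) (T k) j≢k
    ... | inj₁ ij | _ | _ = k , λ l l≢i l≢k →
      beats-also ij λ l≢j → dominating Pi (only l l≢i l≢j l≢k)
    ... | _ | inj₁ ik | _ = j , λ l l≢i l≢j →
      beats-also ik λ l≢k → dominating Pi (only l l≢i l≢j l≢k)
    ... | inj₂ ji | _ | inj₁ jk = contradiction
      (j , λ l l≢j → beats-also ji λ l≢i → beats-also jk λ l≢k → dominating Pj (only l l≢i l≢j l≢k))
      no-source
    ... | _ | inj₂ ki | inj₂ kj = contradiction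
      (k , λ l l≢k → beats-also ki λ l≢i → beats-also kj λ l≢j → dominating Pk (only l l≢i l≢j l≢k))
      no-source

    three-beats : Three P → ∀ {m} → P m → BeatsAllButOne m
    three-beats (i , Pi , j , Pj , i≢j , k , Pk , i≢k , j≢k , only) {m} Pm
      with m ≟ i | m ≟ j | m ≟ k
    ... | yes refl | _ | _ = member-beats Pi Pj Pk i≢j i≢k j≢k only
    ... | _ | yes refl | _ = member-beats Pj Pi Pk (≢-sym i≢j) j≢k i≢k λ l l≢j l≢i → only l l≢i l≢j
    ... | _ | _ | yes refl = member-beats Pk Pi Pj (≢-sym i≢k) (≢-sym j≢k) i≢j
                               λ l l≢k l≢i l≢j → only l l≢i l≢j l≢k
    ... | no m≢i | no m≢j | no m≢k = contradiction Pm (only m m≢i m≢j m≢k)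

-- In a tournament, `A-beats` and `B-loses` force 3-cycles: `q` is the predecessor of `i` on the
-- cycle `A`, and the successor of `i` on the cycle `B`.
record Split (D : Digraph) (T : Choice) (A B : Fin 6 → Set) : Set where
  field
    side     : ∀ i → A i ⊎ B i
    disjoint : ∀ {i} → A i → ¬ B i
    cross    : ∀ {i j} → A i → B j → Arc D T i j
    A-beats  : ∀ {i} → A i → ∃ λ q → ∀ l → l ≢ i → l ≢ q → Arc D T i l
    B-loses  : ∀ {i} → B i → ∃ λ q → ∀ l → l ≢ i → l ≢ q → Arc D T l i
    A-three  : Three A
    B-three  : Three B

Split-ᵒᵖ : ∀ {D T A B} → Split D T A B → Split (D ᵒᵖ) T B A
Split-ᵒᵖ split = record
  { side     = Sum.swap ∘ side
  ; disjoint = λ b a → disjoint a b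
  ; cross    = λ b a → cross a b
  ; A-beats  = B-loses
  ; B-loses  = A-beats
  ; A-three  = B-three
  ; B-three  = A-three
  } where open Split split

cut⇒extremal⊎split : ∀ {D} → Tame D → ∀ {T} → Cut D T →
  ∃ (Source D T) ⊎ ∃ (Source (D ᵒᵖ) T) ⊎ ∃ λ R → Split D T (_∉ R) (_∈ R)
cut⇒extremal⊎split {D} tame {T} cut = analyse (shape lower (inhabited , proper))
  where
  open Cut cut

  in? : Decidable (_∈ lower)
  in? = _∈? lower

  out? : Decidable (_∉ lower)
  out? = ¬? ∘ in?

  above : ∀ {i j} → i ∉ lower → ¬ j ∉ lower → Arc D T i j
  above i∉ ¬j∉ = dominated i∉ (decidable-stable (in? _) ¬j∉)

  below : ∀ {i j} → i ∈ lower → j ∉ lower → Arc (D ᵒᵖ) T i j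
  below i∈ j∉ = dominated j∉ i∈

  analyse : Shape lower → _
  analyse (inj₁ p) = inj₂ (inj₁ (one⇒source (Tame-ᵒᵖ tame) in? below p))
  analyse (inj₂ (inj₁ p)) = inj₁ (one⇒source tame out? above p)
  analyse (inj₂ (inj₂ (inj₁ p))) = inj₂ (inj₁ (two⇒source (Tame-ᵒᵖ tame) in? below p))
  analyse (inj₂ (inj₂ (inj₂ (inj₁ p)))) = inj₁ (two⇒source tame out? above p)
  analyse (inj₂ (inj₂ (inj₂ (inj₂ (three∈ , three∉)))))
    with any? (source? tame T) | any? (source? (Tame-ᵒᵖ tame) T)
  ... | yes source | _ = inj₁ source
  ... | _ | yes sink = inj₂ (inj₁ sink)
  ... | no no-source | no no-sink = inj₂ (inj₂ (lower , record
    { side     = side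
    ; disjoint = λ i∉ i∈ → i∉ i∈
    ; cross    = dominated
    ; A-beats  = three-beats tame out? above no-source three∉
    ; B-loses  = three-beats (Tame-ᵒᵖ tame) in? below no-sink three∈
    ; A-three  = three∉
    ; B-three  = three∈
    }))
    where
    side : ∀ i → i ∉ lower ⊎ i ∈ lower
    side i with in? i
    ... | yes i∈ = inj₂ i∈
    ... | no i∉  = inj₁ i∉

-- Exchanging two parts

fresh : ∀ (xs : List (Fin 6)) → length xs < 6 → ∃ (_∉ˡ xs)
fresh xs short = ¬∀⟶∃¬ 6 _ (_∈ˡ? xs) λ covered → <⇒notInjective short λ {i} {j} eq →
  Membership.index-injective (setoid (Fin 6)) (covered i) (covered j) eq

fresh₄ : ∀ a b c d → ∃ λ w → w ≢ a × w ≢ b × w ≢ c × w ≢ d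
fresh₄ a b c d with fresh (a ∷ b ∷ c ∷ d ∷ []) (s≤s (s≤s (s≤s (s≤s (s≤s z≤n)))))
... | w , w∉ = w , w∉ ∘ here , w∉ ∘ there ∘ here , w∉ ∘ there ∘ there ∘ here
  , w∉ ∘ there ∘ there ∘ there ∘ here

three-avoid : ∀ {P} → Three P → ∀ u v → ∃ λ w → P w × w ≢ u × w ≢ v
three-avoid (i , Pi , j , Pj , i≢j , k , Pk , i≢k , j≢k , _) u v
  with i ≟ u | i ≟ v | j ≟ u | j ≟ v
... | no i≢u   | no i≢v   | _        | _        = i , Pi , i≢u , i≢v
... | _        | _        | no j≢u   | no j≢v   = j , Pj , j≢u , j≢v
... | yes refl | _        | _        | yes refl = k , Pk , ≢-sym i≢k , ≢-sym j≢k
... | _        | yes refl | yes refl | _        = k , Pk , ≢-sym j≢k , ≢-sym i≢k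
... | yes refl | _        | yes j≡i  | _        = contradiction (sym j≡i) i≢j
... | _        | yes refl | _        | yes j≡i  = contradiction (sym j≡i) i≢j

-- The tournament of the exchanged partition that keeps only two members of `T`; `Outer` describes
-- its complement, which keeps the other four.
record Inner (T : Choice) (i j : Fin 6) (U : Choice) : Set where
  field
    atˡ : U i ≡ T i
    atʳ : U j ≡ T j
    off : ∀ {k} → k ≢ i → k ≢ j → U k ≢ T k

record Outer (T : Choice) (i j : Fin 6) (W : Choice) : Set where
  field
    atˡ : W i ≢ T i
    atʳ : W j ≢ T j
    off : ∀ {k} → k ≢ i → k ≢ j → W k ≡ T k

Inner-swap : ∀ {T i j U} → Inner T i j U → Inner T j i U
Inner-swap inner = record { atˡ = atʳ ; atʳ = atˡ ; off = λ k≢j k≢i → off k≢i k≢j }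
  where open Inner inner

Outer-swap : ∀ {T i j W} → Outer T i j W → Outer T j i W
Outer-swap outer = record { atˡ = atʳ ; atʳ = atˡ ; off = λ k≢j k≢i → off k≢i k≢j }
  where open Outer outer

-- The arc between the member m of T and the vertex of part k outside T deviates from the pattern
-- complement of T → A → B → complement of T.
Hit : Digraph → Choice → (A B : Fin 6 → Set) → Fin 6 → Fin 6 → Set
Hit D T A B m k = ∃ λ c → c ≢ T k ×
  (A m × D (m , T m) (k , c) ≡ true ⊎ B m × D (k , c) (m , T m) ≡ true)

TwoHits : Digraph → Choice → (A B : Fin 6 → Set) → Fin 6 → Set
TwoHits D T A B k = ∃₂ λ m n → m ≢ n × Hit D T A B m k × Hit D T A B n k

Hit-ᵒᵖ : ∀ {D T A B m k} → Hit (D ᵒᵖ) T B A m k → Hit D T A B m k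
Hit-ᵒᵖ (c , c≢ , arc) = c , c≢ , Sum.swap arc

TwoHits-ᵒᵖ : ∀ {D T A B k} → TwoHits (D ᵒᵖ) T B A k → TwoHits D T A B k
TwoHits-ᵒᵖ {D} {T} {A} {B} (m , n , m≢n , hit , hit′) =
  m , n , m≢n , Hit-ᵒᵖ {D} {T} {A} {B} hit , Hit-ᵒᵖ {D} {T} {A} {B} hit′

-- Paths and hits after the exchange

module _ {D} (tame : Tame D) {T : Choice} {A B : Fin 6 → Set} (split : Split D T A B) where
  open Split split

  A≢B : ∀ {i j} → A i → B j → i ≢ j
  A≢B Ai Bj refl = disjoint Ai Bj

  -- A member of `A` already beats four members of `T`, so exits into two parts would give it six
  -- out-neighbours. Dually for `B`.
  hit-unique : ∀ {m k l} → Hit D T A B m k → Hit D T A B m l → k ≡ l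
  hit-unique (_ , c≢ , inj₁ (Am , mk)) (_ , d≢ , inj₁ (_ , ml)) =
    exit-unique tame (proj₂ (A-beats Am)) c≢ d≢ mk ml
  hit-unique (_ , c≢ , inj₂ (Bm , km)) (_ , d≢ , inj₂ (_ , lm)) =
    exit-unique (Tame-ᵒᵖ tame) (proj₂ (B-loses Bm)) c≢ d≢ km lm
  hit-unique (_ , _ , inj₁ (Am , _)) (_ , _ , inj₂ (Bm , _)) = contradiction Bm (disjoint Am)
  hit-unique (_ , _ , inj₂ (Bm , _)) (_ , _ , inj₁ (Am , _)) = contradiction Bm (disjoint Am)

  module _ {V : Choice} where
    exit-hit : ∀ {m k} → A m → V m ≡ T m → V k ≢ T k → Arc D V m k → Hit D T A B m k
    exit-hit {m} {k} Am same differ mk =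
      V k , differ , inj₁ (Am , subst (λ c → D (m , c) (k , V k) ≡ _) same mk)

    entry-hit : ∀ {m k} → B m → V m ≡ T m → V k ≢ T k → Arc D V k m → Hit D T A B m k
    entry-hit {m} {k} Bm same differ km =
      V k , differ , inj₂ (Bm , subst (λ c → D (k , V k) (m , c) ≡ _) same km)

    lost : ∀ {i j} → i ≢ j → ¬ Arc D V i j → Arc D V j i
    lost i≢j ¬ij = [ (λ ij → contradiction ij ¬ij) , id ]′ (arc-total tame (V _) (V _) i≢j)

    -- The single hit of `m` is used up by `k`, so its arc with `l` follows the pattern.
    one-exit : ∀ {m k l} → A m → V m ≡ T m → V k ≢ T k → V l ≢ T l → k ≢ l → l ≢ m →
      Arc D V m k → Arc D V l m
    one-exit Am same differ differ′ k≢l l≢m mk = lost (≢-sym l≢m) λ ml →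
      k≢l (hit-unique (exit-hit Am same differ mk) (exit-hit Am same differ′ ml))

    one-entry : ∀ {m k l} → B m → V m ≡ T m → V k ≢ T k → V l ≢ T l → k ≢ l → l ≢ m →
      Arc D V k m → Arc D V m l
    one-entry Bm same differ differ′ k≢l l≢m km = lost l≢m λ lm →
      k≢l (hit-unique (entry-hit Bm same differ km) (entry-hit Bm same differ′ lm))

  -- A foreign `p` either beats `i` or is the only foreign vertex beaten by `i`. In the latter case
  -- an out-neighbour of `p` is `i`, `j` or a foreign vertex, which then beats `i`.
  inner-reach : ∀ {i j U} → A i → B j → Inner T i j U →
    (∀ {k} → k ≢ i → k ≢ j → ¬ Source (D ᵒᵖ) U k) → ∀ p → Reach D U p i
  inner-reach {i} {j} {U} Ai Bj inner no-sink = from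
    where
    open Inner inner

    via : ∀ {w} → Arc D U j w → Arc D U w i → Reach D U j i
    via jw wi = step jw (step wi here)

    -- At most one foreign vertex is beaten by `i` and at most one beats `j`, so among the three
    -- `w`, `v`, `u` some vertex lies on a path of length two from `j` to `i`.
    from-j : Reach D U j i
    from-j with fresh₄ i j i j
    ... | w , w≢i , w≢j , _ with fresh₄ i j w w
    ...   | v , v≢i , v≢j , v≢w , _ with fresh₄ i j w v
    ...     | u , u≢i , u≢j , u≢w , u≢v
      with arc-total tame (U w) (U i) w≢i | arc-total tame (U j) (U w) (≢-sym w≢j)
    ... | inj₁ wi | inj₁ jw = via jw wi
    ... | inj₂ iw | inj₂ wj = via
      (one-entry Bj atʳ (off w≢i w≢j) (off v≢i v≢j) (≢-sym v≢w) v≢j wj)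
      (one-exit Ai atˡ (off w≢i w≢j) (off v≢i v≢j) (≢-sym v≢w) v≢i iw)
    ... | inj₂ iw | inj₁ jw with arc-total tame (U j) (U v) (≢-sym v≢j)
    ...   | inj₁ jv = via jv (one-exit Ai atˡ (off w≢i w≢j) (off v≢i v≢j) (≢-sym v≢w) v≢i iw)
    ...   | inj₂ vj = via
      (one-entry Bj atʳ (off v≢i v≢j) (off u≢i u≢j) (≢-sym u≢v) u≢j vj)
      (one-exit Ai atˡ (off w≢i w≢j) (off u≢i u≢j) (≢-sym u≢w) u≢i iw)
    from-j | w , w≢i , w≢j , _ | v , v≢i , v≢j , v≢w , _ | u , u≢i , u≢j , u≢w , u≢v
      | inj₁ wi | inj₂ wj with arc-total tame (U v) (U i) v≢i
    ...   | inj₁ vi = via (one-entry Bj atʳ (off w≢i w≢j) (off v≢i v≢j) (≢-sym v≢w) v≢j wj) vi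
    ...   | inj₂ iv = via
      (one-entry Bj atʳ (off w≢i w≢j) (off u≢i u≢j) (≢-sym u≢w) u≢j wj)
      (one-exit Ai atˡ (off v≢i v≢j) (off u≢i u≢j) (≢-sym u≢v) u≢i iv)

    from : ∀ p → Reach D U p i
    from p with p ≟ i | p ≟ j
    ... | yes refl | _        = here
    ... | _        | yes refl = from-j
    ... | no p≢i   | no p≢j with arc-total tame (U p) (U i) p≢i
    ...   | inj₁ pi = step pi here
    ...   | inj₂ ip with non-sink tame (no-sink p≢i p≢j)
    ...     | l , pl with l ≟ i | l ≟ j
    ...       | yes refl | _        = step pl here
    ...       | _        | yes refl = step pl from-j
    ...       | no l≢i   | no l≢j   = step pl (step
      (one-exit Ai atˡ (off p≢i p≢j) (off l≢i l≢j) (arc-irrefl tame pl) l≢i ip) here)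

  -- The parts `u` and `v` are excluded so that the vertex of an outer `W` in part `a` is the one of
  -- `T`.
  ReachesA : Choice → (u v p : Fin 6) → Set
  ReachesA W u v p = ∃ λ a → A a × a ≢ u × a ≢ v × Reach D W p a

  -- If `u` does not beat the chosen `a`, then `u` is the only exit of `a`, so `v` beats `a`. An
  -- out-neighbour `l` of `u` is `v`, lies in `A`, or lies in `B`; in the last case `u` is its only
  -- entry, so `l` beats `v`.
  outsider-reach : ∀ {u v W} → u ≢ v → Outer T u v W → ¬ Source (D ᵒᵖ) W u → ReachesA W u v u
  outsider-reach {u} {v} {W} u≢v outer not-sink = via (non-sink tame not-sink)
    where
    open Outer outer
    a : ∃ λ a → A a × a ≢ u × a ≢ v
    a = three-avoid A-three u v

    via : (∃ λ l → Arc D W u l) → ReachesA W u v u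
    via (l , ul) with a | arc-total tame (W u) (W (proj₁ a)) (≢-sym (proj₁ (proj₂ (proj₂ a))))
    ... | a , Aa , a≢u , a≢v | inj₁ ua = a , Aa , a≢u , a≢v , step ua here
    ... | a , Aa , a≢u , a≢v | inj₂ au with l ≟ v
    ...   | yes refl = a , Aa , a≢u , a≢v , step ul (step va here)
      where va = one-exit Aa (off a≢u a≢v) atˡ atʳ u≢v (≢-sym a≢v) au
    ...   | no l≢v with side l
    ...     | inj₁ Al = l , Al , ≢-sym (arc-irrefl tame ul) , l≢v , step ul here
    ...     | inj₂ Bl = a , Aa , a≢u , a≢v , step ul (step lv (step va here))
      where
      va = one-exit Aa (off a≢u a≢v) atˡ atʳ u≢v (≢-sym a≢v) au
      lv = one-entry Bl (off (≢-sym (arc-irrefl tame ul)) l≢v) atˡ atʳ u≢v (≢-sym l≢v) ul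

  -- At most one of the two foreign vertices beats a given member of `B`, so this member beats the
  -- other.
  outer-reach : ∀ {u v W} → u ≢ v → Outer T u v W →
    ¬ Source (D ᵒᵖ) W u → ¬ Source (D ᵒᵖ) W v → ∀ p → ReachesA W u v p
  outer-reach {u} {v} {W} u≢v outer u-not-sink v-not-sink = from
    where
    open Outer outer
    from-u : ReachesA W u v u
    from-u = outsider-reach u≢v outer u-not-sink

    from-v : ReachesA W u v v
    from-v with outsider-reach (≢-sym u≢v) (Outer-swap outer) v-not-sink
    ... | a , Aa , a≢v , a≢u , r = a , Aa , a≢u , a≢v , r

    prepend : ∀ {p q} → Arc D W p q → ReachesA W u v q → ReachesA W u v p
    prepend pq (a , Aa , a≢u , a≢v , r) = a , Aa , a≢u , a≢v , step pq r

    from : ∀ p → ReachesA W u v p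
    from p with p ≟ u | p ≟ v
    ... | yes refl | _        = from-u
    ... | _        | yes refl = from-v
    ... | no p≢u   | no p≢v with side p
    ...   | inj₁ Ap = p , Ap , p≢u , p≢v , here
    ...   | inj₂ Bp with arc-total tame (W p) (W u) p≢u
    ...     | inj₁ pu = prepend pu from-u
    ...     | inj₂ up = prepend (one-entry Bp (off p≢u p≢v) atˡ atʳ u≢v (≢-sym p≢v) up) from-v

  cross-same : ∀ {V i j} → A i → B j → V i ≡ T i → V j ≡ T j → Arc D V i j
  cross-same {V} {i} {j} Ai Bj eqᵢ eqⱼ rewrite eqᵢ | eqⱼ = cross Ai Bj

  -- One hit is the arc to `j`. The other involves the vertex of `T` in a part `a` of `A`, which is
  -- not in `U`: the source, with five out-neighbours in `U`, cannot beat it and hence loses to it.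
  inner-source-hits : ∀ {i j k U} → A i → B j → Inner T i j U →
    U k ≢ T k → Source D U k → TwoHits D T A B k
  inner-source-hits {i} {j} {k} {U} Ai Bj inner k-off src with three-avoid A-three i k
  ... | a , Aa , a≢i , a≢k = j , a , ≢-sym (A≢B Aa Bj)
    , entry-hit Bj atʳ k-off (src j λ { refl → k-off atʳ })
    , (U k , k-off , inj₁ (Aa , [ id , (λ ka → contradiction ka (source-loses tame src T-a≢U-a)) ]′
        (arc-total tame (T a) (U k) a≢k)))
    where
    open Inner inner
    T-a≢U-a : T a ≢ U a
    T-a≢U-a = ≢-sym (off a≢i (A≢B Aa Bj))

  -- `W` keeps the two members of `B` other than `j`, and the source beats both.
  outer-source-hits : ∀ {i j k W} → A i → B j → Outer T i j W →
    W k ≢ T k → Source D W k → TwoHits D T A B k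
  outer-source-hits {i} {j} {k} {W} Ai Bj outer k-off src with three-avoid B-three j j
  ... | b , Bb , b≢j , _ with three-avoid B-three j b
  ...   | b′ , Bb′ , b′≢j , b′≢b = b , b′ , ≢-sym b′≢b , hit Bb b≢j , hit Bb′ b′≢j
    where
    open Outer outer
    hit : ∀ {l} → B l → l ≢ j → Hit D T A B l k
    hit Bl l≢j = entry-hit Bl same k-off (src _ λ { refl → k-off same })
      where same = off (≢-sym (A≢B Ai Bl)) l≢j

-- `Fin 2` encodes the role, which makes roles countable: a source of `orient 1F D` is a sink of
-- `D`.
orient : Fin 2 → Digraph → Digraph
orient 0F D = D
orient 1F D = D ᵒᵖ

Tame-orient : ∀ {D} → Tame D → ∀ σ → Tame (orient σ D)
Tame-orient tame 0F = tame
Tame-orient tame 1F = Tame-ᵒᵖ tame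

two-valued : ∀ {c d e : Fin 2} → c ≢ e → d ≢ e → c ≡ d
two-valued {0F} {0F} _ _ = refl
two-valued {1F} {1F} _ _ = refl
two-valued {0F} {1F} {0F} c≢e _ = contradiction refl c≢e
two-valued {0F} {1F} {1F} _ d≢e = contradiction refl d≢e
two-valued {1F} {0F} {0F} _ d≢e = contradiction refl d≢e
two-valued {1F} {0F} {1F} c≢e _ = contradiction refl c≢e

opposite-≢ : ∀ (c : Fin 2) → opposite c ≢ c
opposite-≢ 0F ()
opposite-≢ 1F ()

half : Fin 2 → Choice → Choice
half 0F T = T
half 1F T = opposite ∘ T

remQuot-injective : ∀ {m} n {p q : Fin (m * n)} → remQuot {m} n p ≡ remQuot n q → p ≡ q
remQuot-injective {m} n {p} {q} eq =
  trans (sym (combine-remQuot {m} n p)) (trans (cong (uncurry combine) eq) (combine-remQuot {m} n q))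

extremal-unique : ∀ {D} → Tame D → ∀ {V V′ σ σ′ k k′} → σ ≡ σ′ → k ≡ k′ → V k ≡ V′ k′ →
  Source (orient σ D) V k → Source (orient σ′ D) V′ k′ → V ≗ V′
extremal-unique tame {σ = σ} refl refl = source-unique (Tame-orient tame σ)

-- Strong connectivity of the exchanged tournaments

Pattern : Choice → Fin 6 → Fin 6 → Choice → Set
Pattern T i j V = Inner T i j V ⊎ Outer T i j V

mixed : Choice → Fin 6 → Fin 6 → Choice
mixed T i j l with l ≟ i | l ≟ j
... | yes _ | _     = T l
... | _     | yes _ = T l
... | no _  | no _  = opposite (T l)

mixed-inner : ∀ T i j → Inner T i j (mixed T i j)
mixed-inner T i j = record { atˡ = atˡ ; atʳ = atʳ ; off = off }
  where
  atˡ : mixed T i j i ≡ T i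
  atˡ with i ≟ i | i ≟ j
  ... | yes _  | _ = refl
  ... | no i≢i | _ = contradiction refl i≢i
  atʳ : mixed T i j j ≡ T j
  atʳ with j ≟ i | j ≟ j
  ... | yes _ | _      = refl
  ... | no _  | yes _  = refl
  ... | no _  | no j≢j = contradiction refl j≢j
  off : ∀ {k} → k ≢ i → k ≢ j → mixed T i j k ≢ T k
  off {k} k≢i k≢j with k ≟ i | k ≟ j
  ... | yes k≡i | _       = contradiction k≡i k≢i
  ... | no _    | yes k≡j = contradiction k≡j k≢j
  ... | no _    | no _    = opposite-≢ (T k)

opposite-outer : ∀ {T i j U} → Inner T i j U → Outer T i j (opposite ∘ U)
opposite-outer {U = U} inner = record
  { atˡ = λ eq → opposite-≢ _ (trans eq (sym atˡ))
  ; atʳ = λ eq → opposite-≢ _ (trans eq (sym atʳ))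
  ; off = λ {k} k≢i k≢j → two-valued (opposite-≢ (U k)) (≢-sym (off k≢i k≢j))
  } where open Inner inner

half-pattern : ∀ T i j h → Pattern T i j (half h (mixed T i j))
half-pattern T i j 0F = inj₁ (mixed-inner T i j)
half-pattern T i j 1F = inj₂ (opposite-outer (mixed-inner T i j))

NotExtremalOutside : Digraph → Choice → Choice → Set
NotExtremalOutside D T V = ∀ σ k → V k ≢ T k → ¬ Source (orient σ D) V k

module _ {D} (tame : Tame D) {T : Choice} {A B : Fin 6 → Set} (split : Split D T A B) where
  open Split split

  -- Every vertex reaches `i`, the arc from `i` to `j` is inherited from `T`, and by reversal `j`
  -- reaches every vertex.
  inner-strong : ∀ {i j U} → A i → B j → Inner T i j U → NotExtremalOutside D T U →
    StronglyConnected D U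
  inner-strong Ai Bj inner not-extremal p q = reach-trans
    (inner-reach tame split Ai Bj inner (λ k≢i k≢j → not-extremal 1F _ (off k≢i k≢j)) p)
    (step (cross-same tame split Ai Bj atˡ atʳ)
      (reach-ᵒᵖ (inner-reach (Tame-ᵒᵖ tame) (Split-ᵒᵖ split) Bj Ai (Inner-swap inner)
        (λ k≢j k≢i → not-extremal 0F _ (off k≢i k≢j)) q)))
    where open Inner inner

  outer-strong : ∀ {i j W} → i ≢ j → Outer T i j W → NotExtremalOutside D T W →
    StronglyConnected D W
  outer-strong {i} {j} i≢j outer not-extremal p q
    with outer-reach tame split i≢j outer (not-extremal 1F i atˡ) (not-extremal 1F j atʳ) p
       | outer-reach (Tame-ᵒᵖ tame) (Split-ᵒᵖ split) i≢j outer (not-extremal 0F i atˡ) (not-extremal 0F j atʳ) q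
    where open Outer outer
  ... | a , Aa , a≢i , a≢j , pa | b , Bb , b≢i , b≢j , qb =
    reach-trans pa (step (cross-same tame split Aa Bb (off a≢i a≢j) (off b≢i b≢j)) (reach-ᵒᵖ qb))
    where open Outer outer

  pattern-hits : ∀ {i j k V} → A i → B j → Pattern T i j V → V k ≢ T k →
    ∀ σ → Source (orient σ D) V k → TwoHits D T A B k
  pattern-hits Ai Bj (inj₁ inner) off 0F src = inner-source-hits tame split Ai Bj inner off src
  pattern-hits Ai Bj (inj₂ outer) off 0F src = outer-source-hits tame split Ai Bj outer off src
  pattern-hits Ai Bj (inj₁ inner) off 1F src = TwoHits-ᵒᵖ {D} {T} {A} {B}
    (inner-source-hits (Tame-ᵒᵖ tame) (Split-ᵒᵖ split) Bj Ai (Inner-swap inner) off src)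
  pattern-hits Ai Bj (inj₂ outer) off 1F src = TwoHits-ᵒᵖ {D} {T} {A} {B}
    (outer-source-hits (Tame-ᵒᵖ tame) (Split-ᵒᵖ split) Bj Ai (Outer-swap outer) off src)

  one-of : ∀ {i j i′ j′} → A i → B j → A i′ → B j′ →
    (i ≡ i′ ⊎ i ≡ j′) → (j ≡ i′ ⊎ j ≡ j′) → i ≡ i′ × j ≡ j′
  one-of Ai Bj Ai′ Bj′ (inj₁ i≡) (inj₂ j≡) = i≡ , j≡
  one-of Ai Bj Ai′ Bj′ (inj₂ refl) _ = contradiction Bj′ (disjoint Ai)
  one-of Ai Bj Ai′ Bj′ _ (inj₁ refl) = contradiction Bj (disjoint Ai′)

  -- The pair consists of the parts where `V` agrees with `T` (inner) or differs from it (outer).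
  -- The two kinds cannot coincide: they disagree at any part outside both pairs.
  pattern-injective : ∀ {i j i′ j′ V V′} → A i → B j → A i′ → B j′ →
    Pattern T i j V → Pattern T i′ j′ V′ → V ≗ V′ → i ≡ i′ × j ≡ j′
  pattern-injective {V = V} {V′} Ai Bj Ai′ Bj′ (inj₁ inner) (inj₁ inner′) V≗V′ =
    one-of Ai Bj Ai′ Bj′ (agree (Inner.atˡ inner)) (agree (Inner.atʳ inner))
    where
    agree : ∀ {l} → V l ≡ T l → l ≡ _ ⊎ l ≡ _
    agree {l} eq with l ≟ _ | l ≟ _
    ... | yes l≡i | _       = inj₁ l≡i
    ... | _       | yes l≡j = inj₂ l≡j
    ... | no l≢i  | no l≢j  = contradiction (trans (sym (V≗V′ l)) eq) (Inner.off inner′ l≢i l≢j)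
  pattern-injective {V = V} {V′} Ai Bj Ai′ Bj′ (inj₂ outer) (inj₂ outer′) V≗V′ =
    one-of Ai Bj Ai′ Bj′ (differ (Outer.atˡ outer)) (differ (Outer.atʳ outer))
    where
    differ : ∀ {l} → V l ≢ T l → l ≡ _ ⊎ l ≡ _
    differ {l} neq with l ≟ _ | l ≟ _
    ... | yes l≡i | _       = inj₁ l≡i
    ... | _       | yes l≡j = inj₂ l≡j
    ... | no l≢i  | no l≢j  = contradiction (trans (V≗V′ l) (Outer.off outer′ l≢i l≢j)) neq
  pattern-injective {i} {j} {i′} {j′} _ _ _ _ (inj₁ inner) (inj₂ outer) V≗V′
    with fresh₄ i j i′ j′
  ... | w , w≢i , w≢j , w≢i′ , w≢j′ = contradiction
    (trans (V≗V′ w) (Outer.off outer w≢i′ w≢j′)) (Inner.off inner w≢i w≢j)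
  pattern-injective {i} {j} {i′} {j′} _ _ _ _ (inj₂ outer) (inj₁ inner) V≗V′
    with fresh₄ i j i′ j′
  ... | w , w≢i , w≢j , w≢i′ , w≢j′ = contradiction
    (trans (sym (V≗V′ w)) (Outer.off outer w≢i w≢j)) (Inner.off inner w≢i′ w≢j′)

  -- Counting the hits of spoiled exchanges

  record Spoiled (i j : Fin 6) : Set where
    constructor spoiled
    field
      h        : Fin 2
      sign     : Fin 2
      k        : Fin 6
      outside  : half h (mixed T i j) k ≢ T k
      extremal : Source (orient sign D) (half h (mixed T i j)) k

  spoiled? : ∀ i j → Dec (Spoiled i j)
  spoiled? i j = map′
    (λ { (h , σ , k , outside , extremal) → spoiled h σ k outside extremal })
    (λ { (spoiled h σ k outside extremal) → h , σ , k , outside , extremal })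
    (any? λ h → any? λ σ → any? λ k → ¬? (half h (mixed T i j) k ≟ T k)
      ×-dec source? (Tame-orient tame σ) (half h (mixed T i j)) k)

  α β : Fin 3 → Fin 6
  α = three-enumerate A-three
  β = three-enumerate B-three

  not-all-spoiled : ¬ (∀ m n → Spoiled (α m) (β n))
  not-all-spoiled all-spoiled = <⇒notInjective 12<18 injective
    where
    12<18 : 12 < 18
    12<18 = ℕ.m≤m+n 13 5

    module S m n = Spoiled (all-spoiled m n)

    hits : ∀ m n → TwoHits D T A B (S.k m n)
    hits m n = pattern-hits (three-member A-three m) (three-member B-three n)
      (half-pattern T (α m) (β n) (S.h m n)) (S.outside m n) (S.sign m n) (S.extremal m n)

    hitter : Fin 3 → Fin 3 → Fin 2 → Fin 6
    hitter m n 0F = proj₁ (hits m n)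
    hitter m n 1F = proj₁ (proj₂ (hits m n))

    hitter-hits : ∀ m n e → Hit D T A B (hitter m n e) (S.k m n)
    hitter-hits m n 0F = proj₁ (proj₂ (proj₂ (proj₂ (hits m n))))
    hitter-hits m n 1F = proj₂ (proj₂ (proj₂ (proj₂ (hits m n))))

    hitter-injective : ∀ m n {e e′} → hitter m n e ≡ hitter m n e′ → e ≡ e′
    hitter-injective m n {0F} {0F} _  = refl
    hitter-injective m n {1F} {1F} _  = refl
    hitter-injective m n {0F} {1F} eq = contradiction eq (proj₁ (proj₂ (proj₂ (hits m n))))
    hitter-injective m n {1F} {0F} eq = contradiction (sym eq) (proj₁ (proj₂ (proj₂ (hits m n))))

    -- Part `k` has a single vertex outside `T`; with its role it determines the tournament by
    -- `extremal-unique`, and the tournament determines the pair.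
    determined : ∀ {m n m′ n′} → S.sign m n ≡ S.sign m′ n′ → S.k m n ≡ S.k m′ n′ →
      m ≡ m′ × n ≡ n′
    determined {m} {n} {m′} {n′} sign≡ k≡ =
      let i≡ , j≡ = pattern-injective
            (three-member A-three m) (three-member B-three n)
            (three-member A-three m′) (three-member B-three n′)
            (half-pattern T (α m) (β n) (S.h m n)) (half-pattern T (α m′) (β n′) (S.h m′ n′))
            (extremal-unique tame sign≡ k≡
              (two-valued (S.outside m n) (subst (λ l → V′ (S.k m′ n′) ≢ T l) (sym k≡) (S.outside m′ n′)))
              (S.extremal m n) (S.extremal m′ n′))
      in three-injective A-three m m′ i≡ , three-injective B-three n n′ j≡
      where
      V′ = half (S.h m′ n′) (mixed T (α m′) (β n′))

    code : Fin 3 → Fin 3 → Fin 2 → Fin 12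
    code m n e = combine (hitter m n e) (S.sign m n)

    code-injective : ∀ m n e m′ n′ e′ → code m n e ≡ code m′ n′ e′ →
      (m , n) ≡ (m′ , n′) × e ≡ e′
    code-injective m n e m′ n′ e′ eq with combine-injective (hitter m n e) _ _ _ eq
    -- A shared hitter has all its hits in one part, so both extremal vertices lie in that part.
    ... | hitter≡ , sign≡ with determined {m} {n} {m′} {n′} sign≡ (hit-unique tame split
          (hitter-hits m n e)
          (subst (λ l → Hit D T A B l (S.k m′ n′)) (sym hitter≡) (hitter-hits m′ n′ e′)))
    ...   | refl , refl = refl , hitter-injective m n hitter≡

    decode : Fin 18 → (Fin 3 × Fin 3) × Fin 2
    decode p = let mn , e = remQuot {9} 2 p in remQuot {3} 3 mn , e

    injective : Injective _≡_ _≡_ λ p → let (m , n) , e = decode p in code m n e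
    injective {p} {q} eq with code-injective _ _ _ _ _ _ eq
    ... | mn≡ , e≡ = remQuot-injective {9} 2 (cong₂ _,_ (remQuot-injective {3} 3 mn≡) e≡)

  some-unspoiled : ∃₂ λ m n → ¬ Spoiled (α m) (β n)
  some-unspoiled =
    let m , ¬row = ¬∀⟶∃¬ 3 _ (λ m → all? λ n → spoiled? (α m) (β n)) not-all-spoiled
    in m , ¬∀⟶∃¬ 3 _ (λ n → spoiled? (α m) (β n)) ¬row

  unspoiled⇒partition : (∃₂ λ m n → ¬ Spoiled (α m) (β n)) → StrongPartition D
  unspoiled⇒partition (m , n , ¬spoiled) = record
    { T₁       = mixed T (α m) (β n)
    ; T₂       = opposite ∘ mixed T (α m) (β n)
    ; disjoint = λ i → ≢-sym (opposite-≢ _)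
    ; strong₁  = inner-strong Ai Bj (mixed-inner T _ _) λ σ k off src →
        ¬spoiled (spoiled 0F σ k off src)
    ; strong₂  = outer-strong (A≢B tame split Ai Bj) (opposite-outer (mixed-inner T _ _))
        λ σ k off src → ¬spoiled (spoiled 1F σ k off src)
    }
    where
    Ai = three-member A-three m
    Bj = three-member B-three n

  split⇒partition : StrongPartition D
  split⇒partition = unspoiled⇒partition some-unspoiled

-- Counting partitions

funToFin-cong : ∀ {m n} {f g : Fin m → Fin n} → f ≗ g → funToFin f ≡ funToFin g
funToFin-cong {zero}  f≗g = refl
funToFin-cong {suc m} f≗g = cong₂ combine (f≗g 0F) (funToFin-cong (f≗g ∘ suc))

finToFun-injective : ∀ {m n} {p q : Fin (m ℕ.^ n)} → finToFun {m} {n} p ≗ finToFun q → p ≡ q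
finToFun-injective {m} {n} {p} {q} p≗q =
  trans (sym (funToFin-finToFin {n} {m} p)) (trans (funToFin-cong p≗q) (funToFin-finToFin {n} {m} q))

-- Fixing the vertex of part 0 lists each of the 2^5 partitions once, by the half that contains this
-- vertex.
choice : Fin 32 → Choice
choice p 0F      = 0F
choice p (suc i) = finToFun {2} {5} p i

half-injective : ∀ {h h′ p p′} → half h (choice p) ≗ half h′ (choice p′) → p ≡ p′
half-injective {0F} {0F} eq = finToFun-injective {2} {5} λ i → eq (suc i)
half-injective {1F} {1F} {p} {p′} eq = finToFun-injective {2} {5} λ i →
  trans (sym (opposite-involutive (choice p (suc i))))
    (trans (cong opposite (eq (suc i))) (opposite-involutive (choice p′ (suc i))))
half-injective {0F} {1F} eq = contradiction (eq 0F) λ ()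
half-injective {1F} {0F} eq = contradiction (eq 0F) λ ()

module _ {D} (tame : Tame D) where

  Extremal : Choice → Set
  Extremal T = ∃ λ h → ∃ λ σ → ∃ λ k → Source (orient σ D) (half h T) k

  extremal? : ∀ T → Dec (Extremal T)
  extremal? T = any? λ h → any? λ σ → any? λ k → source? (Tame-orient tame σ) (half h T) k

  -- An extremal vertex and its role determine the half, hence the partition; 12 vertices with 2
  -- roles give only 24 codes for 32 partitions.
  not-all-extremal : ¬ (∀ p → Extremal (choice p))
  not-all-extremal all-extremal = <⇒notInjective 24<32 injective
    where
    24<32 : 24 < 32
    24<32 = ℕ.m≤m+n 25 7

    V : Fin 32 → Choice
    V p = half (proj₁ (all-extremal p)) (choice p)

    σ : Fin 32 → Fin 2
    σ p = proj₁ (proj₂ (all-extremal p))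

    k : Fin 32 → Fin 6
    k p = proj₁ (proj₂ (proj₂ (all-extremal p)))

    source : ∀ p → Source (orient (σ p) D) (V p) (k p)
    source p = proj₂ (proj₂ (proj₂ (all-extremal p)))

    determined : ∀ {p q} → k p ≡ k q → V p (k p) ≡ V q (k q) → σ p ≡ σ q → p ≡ q
    determined {p} {q} k≡ c≡ σ≡ = half-injective {proj₁ (all-extremal p)} {proj₁ (all-extremal q)}
      (extremal-unique tame σ≡ k≡ c≡ (source p) (source q))

    code : Fin 32 → Fin 24
    code p = combine {12} (combine (k p) (V p (k p))) (σ p)

    injective : Injective _≡_ _≡_ code
    injective {p} {q} eq with combine-injective {12} _ _ _ _ eq
    ... | v≡ , σ≡ with combine-injective (k p) _ _ _ v≡
    ...   | k≡ , c≡ = determined k≡ c≡ σ≡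

  -- A half that is not strong has a cut; without source or sink the cut is a split, and the
  -- exchange then yields another partition that is strong.
  not-extremal⇒partition : ∀ {T} → ¬ Extremal T → StrongPartition D
  not-extremal⇒partition {T} ¬extremal = both (strong⊎partition 0F) (strong⊎partition 1F)
    where
    cut⇒partition : ∀ h → ∃ (Source D (half h T)) ⊎ ∃ (Source (D ᵒᵖ) (half h T)) ⊎
      (∃ λ R → Split D (half h T) (_∉ R) (_∈ R)) → StrongPartition D
    cut⇒partition h (inj₁ (k , source))       = contradiction (h , 0F , k , source) ¬extremal
    cut⇒partition h (inj₂ (inj₁ (k , sink)))  = contradiction (h , 1F , k , sink) ¬extremal
    cut⇒partition h (inj₂ (inj₂ (R , split))) = split⇒partition tame split

    strong⊎partition : ∀ h → StronglyConnected D (half h T) ⊎ StrongPartition D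
    strong⊎partition h =
      Sum.map₂ (cut⇒partition h ∘ cut⇒extremal⊎split tame) (strong⊎cut tame (half h T))

    both : StronglyConnected D T ⊎ StrongPartition D →
      StronglyConnected D (opposite ∘ T) ⊎ StrongPartition D → StrongPartition D
    both (inj₂ partition) _                = partition
    both (inj₁ _)         (inj₂ partition) = partition
    both (inj₁ strong)    (inj₁ strong′)   = record
      { T₁       = T
      ; T₂       = opposite ∘ T
      ; disjoint = λ i → ≢-sym (opposite-≢ (T i))
      ; strong₁  = strong
      ; strong₂  = strong′
      }

  strongPartition : StrongPartition D
  strongPartition =
    not-extremal⇒partition (proj₂ (¬∀⟶∃¬ 32 _ (extremal? ∘ choice) not-all-extremal))

theorem4p4 : (D : Digraph) → IsMultipartiteTournament D → IsRegular D → StrongPartition D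
theorem4p4 D tournament regular = strongPartition (regular⇒tame tournament regular)
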